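{- Let $k\geq 3$. Every graph $G$ with maximum degree $\Delta(G)\le k$ is $(1^{k-1},2^{k})$-packing colorable.
   Context: Graphs are finite and simple; $\mathrm{dist}(x,y)$ is the usual shortest-path distance. For a non-decreasing sequence of positive integers $S=(s_1,\dots,s_p)$, an $S$-packing coloring of $G$ is a partition of $V(G)$ into sets $V_1,\dots,V_p$ such that any two distinct vertices of $V_i$ are at distance greater than $s_i$, for each $1\le i\le p$; $G$ is $S$-packing colorable if such a partition exists. The notation $i^r$ in a sequence means that $i$ is repeated $r$ times, so $(1^{k-1},2^{k})$ is the sequence of $k-1$ ones followed by $k$ twos. -}

module Defs where

open import Data.Nat using (ℕ; zero; suc; _≤_; _∸_; _+_)
open import Data.Bool using (Bool; true; false)
open import Data.Fin using (Fin)
open import Data.List using (length; filter; allFin)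
open import Data.Vec using (Vec; replicate; _++_; lookup)
open import Relation.Binary.PropositionalEquality using (_≡_)
open import Relation.Nullary using (¬_)
open import Data.Bool.Properties using (T?)
open import Data.Product using (Σ)

record Graph : Set where
  field
    n     : ℕ
    adj   : Fin n → Fin n → Bool
    sym   : ∀ x y → adj x y ≡ adj y x
    irrefl : ∀ x → adj x x ≡ false

open Graph public

degree : (G : Graph) → Fin (n G) → ℕ
degree G v = length (filter (λ w → T? (adj G v w)) (allFin (n G)))

MaxDegree≤ : Graph → ℕ → Set
MaxDegree≤ G k = ∀ v → degree G v ≤ k

data Walk (G : Graph) : Fin (n G) → Fin (n G) → ℕ → Set where
  nil  : ∀ {x} → Walk G x x 0
  cons : ∀ {x y z l} → adj G x y ≡ true → Walk G y z l → Walk G x z (suc l)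

-- dist(x,y) > s : no walk (hence no path) of length ≤ s from x to y
-- (also holds when x and y are in different components, dist = ∞)
DistGreater : (G : Graph) → Fin (n G) → Fin (n G) → ℕ → Set
DistGreater G x y s = ∀ l → l ≤ s → ¬ Walk G x y l

-- S-packing coloring for S = (s_1,...,s_p): partition of V(G) into
-- classes V_1..V_p, given as a colour map c : V(G) → Fin p.
IsSPackingColoring : (G : Graph) {p : ℕ} → Vec ℕ p → (Fin (n G) → Fin p) → Set
IsSPackingColoring G S c =
  ∀ x y → ¬ (x ≡ y) → c x ≡ c y → DistGreater G x y (lookup S (c x))

SPackingColorable : (G : Graph) {p : ℕ} → Vec ℕ p → Set
SPackingColorable G {p} S = Σ (Fin (n G) → Fin p) (IsSPackingColoring G S)

seq1^2^ : (k : ℕ) → Vec ℕ ((k ∸ 1) + k)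
seq1^2^ k = replicate (k ∸ 1) 1 ++ replicate k 2

{-# OPTIONS --safe #-}
module Submission where

-- Weigh a partial colouring by 0, 1 or 2 for each vertex that lies in a class of radius 1, lies in
-- a class of radius 2, or is uncoloured, and take one of minimal weight.  A vertex outside the
-- k − 1 classes of radius 1 then sees all of them, so it has at most one surplus neighbour.  Suppose
-- that v is uncoloured.  Exchanging v with a neighbour x that is alone in its class around v
-- preserves the weight, hence x too has at most one further neighbour outside.  Recolouring v from
-- the k colours of radius 2 fails only if its conflicts use every neighbour of v.  If the surplus
-- neighbour of v lies outside, the defect can be moved to a vertex y with two neighbours in one
-- class.  Around such a vertex all other neighbours carry no conflict, and either the two neighbours
-- carry at most one each, or one of them can change its class and then all conflicts go through it.
-- In every case a colour remains, so the minimal colouring is total.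

open import Defs
open import Data.Nat using (ℕ; zero; suc; _≤_; _<_; _+_; z≤n; s≤s)
import Data.Nat.Properties as ℕ
open import Data.Nat.Induction using (<-wellFounded)
open import Induction.WellFounded using (Acc; acc)
open import Data.Bool using (true)
open import Data.Bool.Properties using (T?; T-≡)
import Data.Bool.Properties as Bool
open import Data.Fin using (Fin; zero; suc; _↑ˡ_; _↑ʳ_; splitAt)
open import Data.Fin.Properties
  using (_≟_; any?; all?; ¬∀⟶∃¬; injective⇒≤; ↑ˡ-injective; ↑ʳ-injective; splitAt-↑ˡ; splitAt-↑ʳ)
open import Data.List using (allFin)
import Data.List.Relation.Unary.Any as Any
open import Data.List.Membership.Propositional using (_∈_)
open import Data.List.Membership.Propositional.Properties using (∈-filter⁺; ∈-allFin)
import Data.List.Membership.Setoid.Properties as Membership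
open import Data.Vec using (Vec; []; _∷_; lookup; replicate; _[_]≔_)
open import Data.Vec.Properties
  using (lookup∘update; lookup∘update′; lookup-++ˡ; lookup-++ʳ; lookup-replicate)
import Data.Vec.Functional as Vector
open import Data.Product using (∃; ∃-syntax; _×_; _,_; proj₁; proj₂)
open import Data.Sum using (_⊎_; inj₁; inj₂; [_,_]′)
open import Data.Empty using (⊥; ⊥-elim)
open import Function using (_∘_)
open import Function.Bundles using (Equivalence)
open import Function.Definitions using (Injective)
open import Relation.Binary.Definitions using (DecidableEquality)
open import Relation.Binary.PropositionalEquality as ≡ using (_≡_; _≢_; refl; trans; cong; subst)
open import Relation.Nullary using (¬_; Dec; yes; no)
open import Relation.Nullary.Decidable using (map′; ¬?; decidable-stable; _×-dec_; _⊎-dec_; _→-dec_)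
open import Relation.Unary using (Decidable)

∷-injective : ∀ {A : Set} {m} {a : A} {f : Fin m → A} →
  (∀ i → f i ≢ a) → Injective _≡_ _≡_ f → Injective _≡_ _≡_ (a Vector.∷ f)
∷-injective f≢a inj {zero}  {zero}  eq = refl
∷-injective f≢a inj {zero}  {suc j} eq = ⊥-elim (f≢a j (≡.sym eq))
∷-injective f≢a inj {suc i} {zero}  eq = ⊥-elim (f≢a i eq)
∷-injective f≢a inj {suc i} {suc j} eq = cong suc (inj eq)

module PartialColourings (G : Graph) (m : ℕ) (Δ≤k : MaxDegree≤ G (3 + m)) where

  -- Adjacency and distance at most two.

  K k : ℕ
  K = 2 + m
  k = 3 + m

  V : Set
  V = Fin (n G)

  Adj : V → V → Set
  Adj x y = adj G x y ≡ true

  Adj? : ∀ x y → Dec (Adj x y)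
  Adj? x y = adj G x y Bool.≟ true

  Adj-sym : ∀ {x y} → Adj x y → Adj y x
  Adj-sym {x} {y} xy = trans (sym G y x) xy

  Adj-irrefl : ∀ {x} → ¬ Adj x x
  Adj-irrefl {x} xx with () ← trans (≡.sym (irrefl G x)) xx

  Adj⇒≢ : ∀ {x y} → Adj x y → x ≢ y
  Adj⇒≢ xy refl = Adj-irrefl xy

  Adj[_] : V → V → Set
  Adj[ a ] y = a ≡ y ⊎ Adj a y

  -- The choice `a = y` covers distance 1, so every vertex at distance 1 or 2 comes with a neighbour
  -- `a` of `x` to which a conflict can be charged.
  Near : V → V → Set
  Near x y = y ≢ x × ∃[ a ] Adj x a × Adj[ a ] y

  Near? : ∀ x y → Dec (Near x y)
  Near? x y = ¬? (y ≟ x) ×-dec any? λ a → Adj? x a ×-dec (a ≟ y ⊎-dec Adj? a y)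

  Near-sym : ∀ {x y} → Near x y → Near y x
  Near-sym (y≢x , a , xa , inj₁ refl) = y≢x ∘ ≡.sym , _ , Adj-sym xa , inj₁ refl
  Near-sym (y≢x , a , xa , inj₂ ay) = y≢x ∘ ≡.sym , a , Adj-sym ay , inj₂ (Adj-sym xa)

  -- The classes V_i of radius 1 are `one i`, those of radius 2 are `two j`, and `none` marks a
  -- vertex that is still uncoloured.
  data Color : Set where
    one  : Fin K → Color
    two  : Fin k → Color
    none : Color

  one-injective : ∀ {i j} → one i ≡ one j → i ≡ j
  one-injective refl = refl

  two-injective : ∀ {i j} → two i ≡ two j → i ≡ j
  two-injective refl = refl

  infix 4 _≟ᶜ_
  _≟ᶜ_ : DecidableEquality Color
  one i ≟ᶜ one j = map′ (cong one) one-injective (i ≟ j)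
  one i ≟ᶜ two j = no λ ()
  one i ≟ᶜ none  = no λ ()
  two i ≟ᶜ one j = no λ ()
  two i ≟ᶜ two j = map′ (cong two) two-injective (i ≟ j)
  two i ≟ᶜ none  = no λ ()
  none  ≟ᶜ one j = no λ ()
  none  ≟ᶜ two j = no λ ()
  none  ≟ᶜ none  = yes refl

  any-color? : {P : Color → Set} → Decidable P → Dec (∃ P)
  any-color? {P} P? =
    map′ [ (λ (i , p) → one i , p) , [ (λ (j , p) → two j , p) , (λ p → none , p) ]′ ]′ split
      (any? (P? ∘ one) ⊎-dec any? (P? ∘ two) ⊎-dec P? none)
    where
    split : ∃ P → (∃ (P ∘ one)) ⊎ (∃ (P ∘ two)) ⊎ P none
    split (one i , p) = inj₁ (i , p)
    split (two j , p) = inj₂ (inj₁ (j , p))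
    split (none  , p) = inj₂ (inj₂ p)

  any-vec? : ∀ l {P : Vec Color l → Set} → Decidable P → Dec (∃ P)
  any-vec? zero P? = map′ (λ p → [] , p) (λ { ([] , p) → p }) (P? [])
  any-vec? (suc l) P? =
    map′ (λ (c , s , p) → c ∷ s , p) (λ { (c ∷ s , p) → c , s , p })
      (any-color? λ c → any-vec? l λ s → P? (c ∷ s))

  -- Partial colourings and conflicts.

  State : Set
  State = Vec Color (n G)

  infix 8 _!_
  _!_ : State → V → Color
  _!_ = lookup

  -- `none` conflicts with nothing, so the entirely uncoloured state is valid and uncolouring a
  -- vertex is always permitted.
  Conflict : Color → V → V → Set
  Conflict (one _) = Adj
  Conflict (two _) = Near
  Conflict none    = λ _ _ → ⊥

  Conflict? : ∀ c x y → Dec (Conflict c x y)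
  Conflict? (one _) = Adj?
  Conflict? (two _) = Near?
  Conflict? none    = λ _ _ → no λ ()

  Conflict-sym : ∀ c {x y} → Conflict c x y → Conflict c y x
  Conflict-sym (one _) = Adj-sym
  Conflict-sym (two _) = Near-sym

  Conflict-irrefl : ∀ c {x} → ¬ Conflict c x x
  Conflict-irrefl (one _) = Adj-irrefl
  Conflict-irrefl (two _) (x≢x , _) = x≢x refl

  Valid : State → Set
  Valid s = ∀ x y → Conflict (s ! x) x y → s ! x ≢ s ! y

  Valid? : Decidable Valid
  Valid? s = all? λ x → all? λ y → Conflict? (s ! x) x y →-dec ¬? (s ! x ≟ᶜ s ! y)

  Fits : State → V → Color → Set
  Fits s x c = ∀ y → Conflict c x y → s ! y ≢ c

  updated : ∀ s x c → (s [ x ]≔ c) ! x ≡ c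
  updated s x c = lookup∘update x s c

  kept : ∀ s {x y} c → y ≢ x → (s [ x ]≔ c) ! y ≡ s ! y
  kept s c y≢x = lookup∘update′ y≢x s c

  update-Valid : ∀ s x c → Valid s → Fits s x c → Valid (s [ x ]≔ c)
  update-Valid s x c valid fits y z with y ≟ x | z ≟ x
  ... | yes refl | yes refl = λ conf _ → Conflict-irrefl ((s [ x ]≔ c) ! x) conf
  ... | yes refl | no z≢x
    rewrite updated s x c | kept s c z≢x = λ conf eq → fits z conf (≡.sym eq)
  ... | no y≢x | yes refl
    rewrite updated s x c | kept s c y≢x =
      λ conf eq → fits y (subst (λ d → Conflict d x y) eq (Conflict-sym (s ! y) conf)) eq
  ... | no y≢x | no z≢x
    rewrite kept s c y≢x | kept s c z≢x = valid y z

  -- Weights and minimal colourings.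

  cost : Color → ℕ
  cost (one _) = 0
  cost (two _) = 1
  cost none    = 2

  weight : ∀ {l} → Vec Color l → ℕ
  weight []      = 0
  weight (c ∷ s) = cost c + weight s

  weight-update : ∀ {l} (s : Vec Color l) x c →
    weight (s [ x ]≔ c) + cost (lookup s x) ≡ weight s + cost c
  weight-update (d ∷ s) zero c =
    trans (ℕ.+-comm (cost c + weight s) (cost d))
      (trans (cong (cost d +_) (ℕ.+-comm (cost c) (weight s)))
        (≡.sym (ℕ.+-assoc (cost d) (weight s) (cost c))))
  weight-update (d ∷ s) (suc x) c =
    trans (ℕ.+-assoc (cost d) (weight (s [ x ]≔ c)) (cost (lookup s x)))
      (trans (cong (cost d +_) (weight-update s x c))
        (≡.sym (ℕ.+-assoc (cost d) (weight s) (cost c))))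

  record Optimal (s : State) : Set where
    field
      valid   : Valid s
      minimal : ∀ t → Valid t → weight s ≤ weight t

  open Optimal

  -- Descent on the weight: there are finitely many states and validity is decidable, so a cheaper
  -- valid state is either found or excluded.
  optimal-below : ∀ s → Valid s → Acc _<_ (weight s) → ∃ Optimal
  optimal-below s valid (acc rec)
    with any-vec? (n G) (λ t → Valid? t ×-dec (weight t ℕ.<? weight s))
  ... | yes (t , valid′ , t<s) = optimal-below t valid′ (rec t<s)
  ... | no  ∄ = s , record { valid = valid ; minimal = λ t v → ℕ.≮⇒≥ λ t<s → ∄ (t , v , t<s) }

  ∃-Optimal : ∃ Optimal
  ∃-Optimal = optimal-below (replicate (n G) none) uncoloured (<-wellFounded _)
    where
    uncoloured : Valid (replicate (n G) none)
    uncoloured x y conf = ⊥-elim (subst (λ c → Conflict c x y) (lookup-replicate x none) conf)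

  not-cheaper : ∀ s x c → Optimal s → Fits s x c → ¬ cost c < cost (s ! x)
  not-cheaper s x c opt fits c<x =
    ℕ.<⇒≱ c<x (ℕ.+-cancelˡ-≤ (weight s) _ _
      (ℕ.≤-trans
        (ℕ.+-monoˡ-≤ (cost (s ! x)) (minimal opt (s [ x ]≔ c) (update-Valid s x c (valid opt) fits)))
        (ℕ.≤-reflexive (weight-update s x c))))

  transfer-Optimal : ∀ s t → Optimal s → Valid t → weight t ≡ weight s → Optimal t
  transfer-Optimal s t opt valid-t eq = record
    { valid   = valid-t
    ; minimal = λ t′ v → ℕ.≤-trans (ℕ.≤-reflexive eq) (minimal opt t′ v)
    }

  recolour-Optimal : ∀ s x c → Optimal s → Fits s x c → cost c ≡ cost (s ! x) →
    Optimal (s [ x ]≔ c)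
  recolour-Optimal s x c opt fits eq =
    transfer-Optimal s (s [ x ]≔ c) opt (update-Valid s x c (valid opt) fits)
      (ℕ.+-cancelʳ-≡ (cost (s ! x)) _ _
        (trans (weight-update s x c) (cong (weight s +_) eq)))

  -- Only the total change counts: the intermediate state may exceed the minimum, as when one vertex
  -- is uncoloured before another is coloured.
  recolour-two-Optimal : ∀ s x c y d (let t = s [ x ]≔ c) → Optimal s →
    Fits s x c → Fits t y d → cost c + cost d ≡ cost (s ! x) + cost (t ! y) →
    Optimal (t [ y ]≔ d)
  recolour-two-Optimal s x c y d opt fits fits′ eq =
    transfer-Optimal s u opt (update-Valid t y d (update-Valid s x c (valid opt) fits) fits′)
      (ℕ.+-cancelʳ-≡ (cx + cy) _ _ total)
    where
    t = s [ x ]≔ c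
    u = t [ y ]≔ d
    cx = cost (s ! x)
    cy = cost (t ! y)
    total : weight u + (cx + cy) ≡ weight s + (cx + cy)
    total = begin
      weight u + (cx + cy)          ≡⟨ cong (weight u +_) (ℕ.+-comm cx cy) ⟩
      weight u + (cy + cx)          ≡⟨ ℕ.+-assoc (weight u) cy cx ⟨
      weight u + cy + cx            ≡⟨ cong (_+ cx) (weight-update t y d) ⟩
      weight t + cost d + cx        ≡⟨ ℕ.+-assoc (weight t) (cost d) cx ⟩
      weight t + (cost d + cx)      ≡⟨ cong (weight t +_) (ℕ.+-comm (cost d) cx) ⟩
      weight t + (cx + cost d)      ≡⟨ ℕ.+-assoc (weight t) cx (cost d) ⟨
      weight t + cx + cost d        ≡⟨ cong (_+ cost d) (weight-update s x c) ⟩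
      weight s + cost c + cost d    ≡⟨ ℕ.+-assoc (weight s) (cost c) (cost d) ⟩
      weight s + (cost c + cost d)  ≡⟨ cong (weight s +_) eq ⟩
      weight s + (cx + cy)          ∎
      where open ≡.≡-Reasoning

  -- Counting neighbours by class.

  too-many-neighbours : ∀ {v} (f : Fin (suc k) → V) → (∀ i → Adj v (f i)) → ¬ Injective _≡_ _≡_ f
  too-many-neighbours {v} f adjacent inj =
    -- Distinct neighbours have distinct positions in the filtered list whose length is the degree.
    ℕ.1+n≰n (ℕ.≤-trans (injective⇒≤ {f = λ i → Any.index (f∈ i)} index-inj) (Δ≤k v))
    where
    f∈ : ∀ i → f i ∈ _
    f∈ i = ∈-filter⁺ (λ w → T? (adj G v w)) (∈-allFin (f i)) (Equivalence.from T-≡ (adjacent i))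
    index-inj : Injective _≡_ _≡_ (λ i → Any.index (f∈ i))
    index-inj {i} {j} eq = inj (Membership.index-injective (≡.setoid V) (f∈ i) (f∈ j) eq)

  Outside : State → V → Set
  Outside s x = ∀ i → s ! x ≢ one i

  class : ∀ c → (∃[ i ] c ≡ one i) ⊎ (∀ i → c ≢ one i)
  class (one i) = inj₁ (i , refl)
  class (two _) = inj₂ λ _ ()
  class none    = inj₂ λ _ ()

  Outside? : ∀ s x → Dec (Outside s x)
  Outside? s x = all? λ i → ¬? (s ! x ≟ᶜ one i)

  none⇒Outside : ∀ {s x} → s ! x ≡ none → Outside s x
  none⇒Outside x-none i eq with () ← trans (≡.sym x-none) eq

  two⇒Outside : ∀ {s x j} → s ! x ≡ two j → Outside s x
  two⇒Outside x-two i eq with () ← trans (≡.sym x-two) eq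

  Outside-≢ : ∀ {s x y i} → Outside s x → s ! y ≡ one i → x ≢ y
  Outside-≢ out y-one refl = out _ y-one

  Sees : State → V → Fin K → Set
  Sees s v i = ∃[ y ] Adj v y × s ! y ≡ one i

  Sees? : ∀ s v i → Dec (Sees s v i)
  Sees? s v i = any? λ y → Adj? v y ×-dec (s ! y ≟ᶜ one i)

  Private : State → V → Fin K → V → Set
  Private s v i x = ∀ {y} → Adj v y → s ! y ≡ one i → y ≡ x

  -- Otherwise `v` could move into the missing class at cost 0, against minimality.
  outside-sees : ∀ {s v} → Optimal s → Outside s v → ∀ i → Sees s v i
  outside-sees {s} {v} opt out i = decidable-stable (Sees? s v i) λ ¬sees →
    not-cheaper s v (one i) opt (λ y vy y-one → ¬sees (y , vy , y-one)) (positive (s ! v) out)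
    where
    positive : ∀ c → (∀ i → c ≢ one i) → 0 < cost c
    positive (one i) out = ⊥-elim (out i refl)
    positive (two _) out = s≤s z≤n
    positive none    out = s≤s z≤n

  -- One neighbour from each of the `K` classes, together with `a` and `b`, would make
  -- `K + 2 = k + 1` distinct neighbours.
  excess : ∀ s {v a b} → a ≢ b → Adj v a → Adj v b →
    ¬ (∀ i → ∃[ y ] Adj v y × s ! y ≡ one i × y ≢ a × y ≢ b)
  excess s {v} {a} {b} a≢b va vb f = too-many-neighbours
    (a Vector.∷ (b Vector.∷ (proj₁ ∘ f)))
    (λ { zero → va ; (suc zero) → vb ; (suc (suc i)) → proj₁ (proj₂ (f i)) })
    (∷-injective (λ { zero → a≢b ∘ ≡.sym ; (suc i) → proj₁ (proj₂ (proj₂ (proj₂ (f i)))) })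
      (∷-injective (λ i → proj₂ (proj₂ (proj₂ (proj₂ (f i))))) f-inj))
    where
    f-inj : Injective _≡_ _≡_ (proj₁ ∘ f)
    f-inj {i} {j} eq = one-injective (trans (≡.sym (proj₁ (proj₂ (proj₂ (f i)))))
      (trans (cong (s !_) eq) (proj₁ (proj₂ (proj₂ (f j))))))

  -- Assuming only that `v` sees every class allows the use in auxiliary states that need not be
  -- minimal or even valid.
  outside-unique : ∀ {s v a b} → (∀ i → Sees s v i) →
    Adj v a → Outside s a → Adj v b → Outside s b → a ≡ b
  outside-unique {s} {a = a} {b} sees va a-out vb b-out = decidable-stable (a ≟ b) λ a≢b →
    excess s a≢b va vb λ i → let y , vy , y-one = sees i in
      y , vy , y-one , Outside-≢ {s} a-out y-one ∘ ≡.sym , Outside-≢ {s} b-out y-one ∘ ≡.sym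

  -- A second neighbour `y` in class `i` would be surplus along with `w`, since `x` still represents
  -- the class.
  one-private : ∀ {s v w x i} → (∀ i → Sees s v i) → Adj v w → Outside s w →
    Adj v x → s ! x ≡ one i → Private s v i x
  one-private {s} {v} {w} {x} {i} sees vw w-out vx x-one {y} vy y-one =
    decidable-stable (y ≟ x) λ y≢x →
      excess s {v} {y} {w} (Outside-≢ {s} w-out y-one ∘ ≡.sym) vy vw (avoiding y≢x)
    where
    avoiding : y ≢ x → ∀ j → ∃[ z ] Adj v z × s ! z ≡ one j × z ≢ y × z ≢ w
    avoiding y≢x j with j ≟ i | sees j
    ... | yes refl | _ = x , vx , x-one , y≢x ∘ ≡.sym , Outside-≢ {s} w-out x-one ∘ ≡.sym
    ... | no j≢i | z , vz , z-one =
      z , vz , z-one , (λ { refl → j≢i (one-injective (trans (≡.sym z-one) y-one)) }) ,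
      Outside-≢ {s} w-out z-one ∘ ≡.sym

  -- Exchanging an uncoloured vertex with a private neighbour.

  swap : State → V → V → Fin K → State
  swap s v x i = (s [ x ]≔ none) [ v ]≔ one i

  module Swap {s v x i} (opt : Optimal s) (hole : s ! v ≡ none) (vx : Adj v x)
    (x-one : s ! x ≡ one i) (private-x : Private s v i x) where

    s′ : State
    s′ = swap s v x i

    at-v : s′ ! v ≡ one i
    at-v = updated (s [ x ]≔ none) v (one i)

    at-x : s′ ! x ≡ none
    at-x = trans (kept (s [ x ]≔ none) (one i) (Adj⇒≢ vx ∘ ≡.sym)) (updated s x none)

    elsewhere : ∀ {y} → y ≢ v → y ≢ x → s′ ! y ≡ s ! y
    elsewhere y≢v y≢x = trans (kept (s [ x ]≔ none) (one i) y≢v) (kept s none y≢x)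

    Outside′ : ∀ {y} → y ≢ v → Outside s y → Outside s′ y
    Outside′ {y} y≢v out i′ eq =
      out i′ (trans (≡.sym (elsewhere y≢v (Outside-≢ {s} out x-one))) eq)

    Outside⁻ : ∀ {y} → y ≢ x → Outside s′ y → Outside s y
    Outside⁻ {y} y≢x out′ i′ eq =
      out′ i′ (trans (elsewhere (λ { refl → out′ i at-v }) y≢x) eq)

    optimal′ : Optimal s′
    optimal′ = recolour-two-Optimal s x none v (one i) opt (λ _ ()) fits
      (≡.sym (≡.cong₂ _+_ (cong cost x-one) (cong cost (trans (kept s none (Adj⇒≢ vx)) hole))))
      where
      fits : Fits (s [ x ]≔ none) v (one i)
      -- Once `x` is uncoloured, its privacy leaves no neighbour of `v` in class `i`.
      fits y vy eq with y ≟ x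
      ... | yes refl with () ← trans (≡.sym (updated s x none)) eq
      ... | no y≢x = y≢x (private-x vy (trans (≡.sym (kept s none y≢x)) eq))

    -- In `s′` the vertex `x` is uncoloured, so its neighbours in the `K` classes leave room for
    -- only one neighbour outside.
    private-outside-unique : ∀ {y z} → Adj x y → Outside s y → y ≢ v →
      Adj x z → Outside s z → z ≢ v → y ≡ z
    private-outside-unique xy y-out y≢v xz z-out z≢v =
      outside-unique {s′} (outside-sees optimal′ (none⇒Outside {s′} at-x))
        xy (Outside′ y≢v y-out) xz (Outside′ z≢v z-out)

  -- Charging conflicts of radius 2 to neighbours.

  -- Each neighbour of `v` carries at most one possible conflict, which makes the charging
  -- injective.
  Slim : State → V → Set
  Slim s v = ∀ {a y z} → Adj v a → Adj[ a ] y → Outside s y → y ≢ v →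
    Adj[ a ] z → Outside s z → z ≢ v → y ≡ z

  -- A neighbour `a` outside has `v` as its only neighbour outside, so it carries only itself. A
  -- neighbour in a class is private, because `w` is the surplus one, and exchanging it with `v`
  -- bounds what it carries.
  adjacent-outside⇒Slim : ∀ {s v w} → Optimal s → s ! v ≡ none → Adj v w → Outside s w → Slim s v
  adjacent-outside⇒Slim {s} {v} opt hole vw w-out {a} {y} {z} va ay y-out y≢v az z-out z≢v
    with class (s ! a)
  ... | inj₂ a-out = trans (≡.sym (only ay y-out y≢v)) (only az z-out z≢v)
    where
    only : ∀ {b} → Adj[ a ] b → Outside s b → b ≢ v → a ≡ b
    only (inj₁ a≡b) _ _ = a≡b
    only (inj₂ ab) b-out b≢v = ⊥-elim (b≢v (outside-unique {s} (outside-sees opt a-out)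
      ab b-out (Adj-sym va) (none⇒Outside {s} hole)))
  ... | inj₁ (i , a-one) =
    Swap.private-outside-unique opt hole va a-one
      (one-private {s} (outside-sees opt (none⇒Outside {s} hole)) vw w-out va a-one)
      (proper ay y-out) y-out y≢v (proper az z-out) z-out z≢v
    where
    proper : ∀ {b} → Adj[ a ] b → Outside s b → Adj a b
    proper (inj₁ refl) b-out = ⊥-elim (b-out i a-one)
    proper (inj₂ ab) _ = ab

  free-or-blocked : ∀ s v →
    (∃[ j ] Fits s v (two j)) ⊎ (∀ j → ∃[ y ] Near v y × s ! y ≡ two j)
  free-or-blocked s v with all? (λ j → any? λ y → Near? v y ×-dec (s ! y ≟ᶜ two j))
  ... | yes blocked = inj₂ blocked
  ... | no ¬blocked
    with j , free ← ¬∀⟶∃¬ k _ (λ j → any? λ y → Near? v y ×-dec (s ! y ≟ᶜ two j)) ¬blocked =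
    inj₁ (j , λ y near eq → free (y , near , eq))

  -- Each of the k colours that blocks v is charged to its own neighbour of v other than x.
  free-colour : ∀ {s v x} → Slim s v → Adj v x →
    (∀ {y j} → y ≢ v → s ! y ≡ two j → Adj[ x ] y → Adj v y × y ≢ x) →
    ∃[ j ] Fits s v (two j)
  free-colour {s} {v} {x} slim vx idle with free-or-blocked s v
  ... | inj₁ free = free
  ... | inj₂ blocked = ⊥-elim (too-many-neighbours
    (x Vector.∷ (proj₁ ∘ charge))
    (λ { zero → vx ; (suc j) → proj₁ (proj₂ (charge j)) })
    (∷-injective (λ j → proj₂ (proj₂ (proj₂ (charge j)))) charge-inj))
    where
    charge : ∀ j → ∃[ a ] Adj v a × Adj[ a ] (proj₁ (blocked j)) × a ≢ x
    charge j with blocked j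
    ... | y , (y≢v , a , va , ay) , y-two with a ≟ x
    ...   | no a≢x = a , va , ay , a≢x
    -- A conflict reached through `x` is itself a neighbour of `v` and is charged to itself, which
    -- keeps `x` spare.
    ...   | yes refl = let vy , y≢x = idle y≢v y-two ay in y , vy , inj₁ refl , y≢x

    charge-inj : Injective _≡_ _≡_ (proj₁ ∘ charge)
    charge-inj {i} {j} eq =
      two-injective (trans (≡.sym (y-two i)) (trans (cong (s !_) same) (y-two j)))
      where
      y-two : ∀ j → s ! proj₁ (blocked j) ≡ two j
      y-two j = proj₂ (proj₂ (blocked j))
      y≢v : ∀ j → proj₁ (blocked j) ≢ v
      y≢v j = proj₁ (proj₁ (proj₂ (blocked j)))
      same : proj₁ (blocked i) ≡ proj₁ (blocked j)
      same = slim (proj₁ (proj₂ (charge i)))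
        (proj₁ (proj₂ (proj₂ (charge i)))) (two⇒Outside {s} (y-two i)) (y≢v i)
        (subst (λ a → Adj[ a ] _) (≡.sym eq) (proj₁ (proj₂ (proj₂ (charge j)))))
        (two⇒Outside {s} (y-two j)) (y≢v j)

  hole-blocked : ∀ {s v} → Optimal s → s ! v ≡ none → ¬ (∃[ j ] Fits s v (two j))
  hole-blocked {s} {v} opt hole (j , fits) =
    not-cheaper s v (two j) opt fits (subst (λ c → 1 < cost c) (≡.sym hole) (s≤s (s≤s z≤n)))

  -- After the exchange of v and x, the neighbour v of the uncoloured x carries no conflict.
  private-no-other-outside : ∀ {s v x y i} → Optimal s → s ! v ≡ none →
    (∀ {w} → Adj v w → ¬ Outside s w) → Adj v x → s ! x ≡ one i → Private s v i x →
    Adj x y → Outside s y → y ≡ v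
  private-no-other-outside {s} {v} {x} {y} opt hole inside vx x-one private-x xy y-out =
    decidable-stable (y ≟ v) λ y≢v →
      hole-blocked optimal′ at-x (free-colour {s′}
        (adjacent-outside⇒Slim optimal′ at-x xy (Outside′ y≢v y-out)) (Adj-sym vx)
        λ { z≢x z-two (inj₁ refl) → ⊥-elim (two⇒Outside {s′} z-two _ at-v)
          ; z≢x z-two (inj₂ vz) → ⊥-elim (inside vz (Outside⁻ z≢x (two⇒Outside {s′} z-two))) })
    where open Swap opt hole vx x-one private-x

  -- Two neighbours in one class.

  -- The vertex u′ in the class of u makes v see every class even when u′ is uncoloured; u′ then
  -- plays the role of the unique neighbour of v outside the classes of radius 1.
  module Double {s v u u′ j} (opt : Optimal s) (hole : s ! v ≡ none) (u≢u′ : u ≢ u′)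
    (vu : Adj v u) (vu′ : Adj v u′) (u-one : s ! u ≡ one j) (u′-one : s ! u′ ≡ one j) where

    private
      t : State
      t = s [ u′ ]≔ none

      u′-outside : Outside t u′
      u′-outside = none⇒Outside {t} (updated s u′ none)

      sees : ∀ i → Sees t v i
      sees i with i ≟ j | outside-sees opt (none⇒Outside {s} hole) i
      ... | yes refl | _ = u , vu , trans (kept s none u≢u′) u-one
      ... | no i≢j | y , vy , y-one = y , vy ,
        trans (kept s none λ { refl → i≢j (one-injective (trans (≡.sym y-one) u′-one)) }) y-one

    inside : ∀ {w} → Adj v w → ¬ Outside s w
    inside {w} vw w-out = w≢u′ (outside-unique {t} sees vw
      (λ i eq → w-out i (trans (≡.sym (kept s none w≢u′)) eq)) vu′ u′-outside)
      where
      w≢u′ : w ≢ u′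
      w≢u′ refl = w-out j u′-one

    other-private : ∀ {x i} → Adj v x → x ≢ u → x ≢ u′ → s ! x ≡ one i → Private s v i x
    other-private {x} {i} vx x≢u x≢u′ x-one {y} vy y-one with y ≟ u′
    ... | no y≢u′ = one-private {t} sees vu′ u′-outside vx
      (trans (kept s none x≢u′) x-one) vy (trans (kept s none y≢u′) y-one)
    -- Here `y` is `u′`, so `i` is `j`, and `x` would share this class with `u`, which is private in
    -- `t`.
    ... | yes refl = ⊥-elim (x≢u (≡.sym (one-private {t} sees vu′ u′-outside vx
      (trans (kept s none x≢u′) x-one) vu
      (trans (kept s none u≢u′) (trans u-one (trans (≡.sym u′-one) y-one))))))

    other-idle : ∀ {x y} → Adj v x → x ≢ u → x ≢ u′ → Adj[ x ] y → Outside s y → y ≡ v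
    other-idle vx x≢u x≢u′ (inj₁ refl) y-out = ⊥-elim (inside vx y-out)
    other-idle {x} vx x≢u x≢u′ (inj₂ xy) y-out with class (s ! x)
    ... | inj₂ x-out = ⊥-elim (inside vx x-out)
    ... | inj₁ (i , x-one) = private-no-other-outside opt hole inside vx x-one
      (other-private vx x≢u x≢u′ x-one) xy y-out

    -- A vertex u with three neighbours outside misses some class `one l`. Once u has been moved
    -- there, u′ is private to v, so that every conflict of v goes through u.
    crowded : ∀ {y z} → Adj u y → Outside s y → y ≢ v → Adj u z → Outside s z → z ≢ v → y ≡ z
    crowded {y} {z} uy y-out y≢v uz z-out z≢v = decidable-stable (y ≟ z) λ y≢z →
      missing (¬∀⟶∃¬ K (Sees r u) (Sees? r u) λ sees-r →
        y≢z (outside-unique {r} sees-r uy (outside-r y≢v y-out) uz (outside-r z≢v z-out)))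
      where
      -- `r` is not valid, since the adjacent `u` and `v` share class `j`. It only serves to count
      -- the neighbours of `u`, with `v` representing class `j`.
      r : State
      r = s [ v ]≔ one j

      outside-r : ∀ {w} → w ≢ v → Outside s w → Outside r w
      outside-r w≢v w-out i eq = w-out i (trans (≡.sym (kept s (one j) w≢v)) eq)

      missing : ¬ (∃[ l ] ¬ Sees r u l)
      missing (l , ¬sees) = hole-blocked opt hole free
        where
        l≢j : l ≢ j
        l≢j refl = ¬sees (v , Adj-sym vu , updated s v (one j))

        t′ : State
        t′ = s [ u ]≔ one l

        fits : Fits s u (one l)
        fits w uw w-one = ¬sees (w , uw ,
          trans (kept s (one j) (λ { refl → none⇒Outside {s} hole l w-one })) w-one)

        opt′ : Optimal t′
        opt′ = recolour-Optimal s u (one l) opt fits (≡.sym (cong cost u-one))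

        Outside⁺ : ∀ {w} → Outside s w → Outside t′ w
        Outside⁺ w-out i eq =
          w-out i (trans (≡.sym (kept s (one l) (Outside-≢ {s} w-out u-one))) eq)

        Outside⁻ : ∀ {w} → Outside t′ w → Outside s w
        Outside⁻ w-out i eq =
          w-out i (trans (kept s (one l) (λ { refl → w-out l (updated s u (one l)) })) eq)

        private′ : Private t′ v j u′
        private′ {w} vw w-one = decidable-stable (w ≟ u′) λ w≢u′ →
          w≢u′ (≡.sym (other-private vw w≢u w≢u′ w-one-s vu′ u′-one))
          where
          w≢u : w ≢ u
          w≢u refl = l≢j (one-injective (trans (≡.sym (updated s u (one l))) w-one))
          w-one-s : s ! w ≡ one j
          w-one-s = trans (≡.sym (kept s (one l) w≢u)) w-one

        u′-idle : ∀ {w} → Adj u′ w → Outside s w → w ≡ v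
        u′-idle u′w w-out = private-no-other-outside opt′
          (trans (kept s (one l) (Adj⇒≢ vu)) hole) (λ vw → inside vw ∘ Outside⁻) vu′
          (trans (kept s (one l) (u≢u′ ∘ ≡.sym)) u′-one) private′ u′w (Outside⁺ w-out)

        through-u : ∀ {a w} → Adj v a → Adj[ a ] w → Outside s w → w ≢ v → Adj u w
        through-u {a} va aw w-out w≢v with a ≟ u | a ≟ u′ | aw
        ... | yes refl | _ | inj₁ refl = ⊥-elim (w-out j u-one)
        ... | yes refl | _ | inj₂ uw = uw
        ... | no _ | yes refl | inj₁ refl = ⊥-elim (w-out j u′-one)
        ... | no _ | yes refl | inj₂ u′w = ⊥-elim (w≢v (u′-idle u′w w-out))
        ... | no a≢u | no a≢u′ | aw = ⊥-elim (w≢v (other-idle va a≢u a≢u′ aw w-out))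

        free : ∃[ i ] Fits s v (two i)
        free with free-or-blocked s v
        ... | inj₁ free = free
        -- The k blocking vertices are all adjacent to `u`, and with `v` they exceed its degree.
        ... | inj₂ blocked = ⊥-elim (too-many-neighbours (v Vector.∷ (proj₁ ∘ blocked))
          (λ { zero → Adj-sym vu ; (suc i) → adjacent i })
          (∷-injective (λ i → proj₁ (proj₁ (proj₂ (blocked i))))
            λ {i} {i′} eq → two-injective (trans (≡.sym (proj₂ (proj₂ (blocked i))))
              (trans (cong (s !_) eq) (proj₂ (proj₂ (blocked i′)))))))
          where
          adjacent : ∀ i → Adj u (proj₁ (blocked i))
          adjacent i = let w , (w≢v , a , va , aw) , w-two = blocked i in
            through-u va aw (two⇒Outside {s} w-two) w≢v

  -- A second class exists because k is at least 3, so that `K` is at least 2.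
  other-index : ∀ (j : Fin K) → ∃[ i ] i ≢ j
  other-index zero    = suc zero , λ ()
  other-index (suc _) = zero , λ ()

  -- A neighbour `x` in another class carries no conflict and is spare. Only `u` and `u′` can carry
  -- conflicts, at most one each, by `crowded` with the two in either order.
  no-double : ∀ {s v u u′ j} → Optimal s → s ! v ≡ none → u ≢ u′ → Adj v u → Adj v u′ →
    s ! u ≡ one j → s ! u′ ≡ one j → ⊥
  no-double {s} {v} {u} {u′} {j} opt hole u≢u′ vu vu′ u-one u′-one
    with i , i≢j ← other-index j
    with x , vx , x-one ← outside-sees opt (none⇒Outside {s} hole) i =
    hole-blocked opt hole (free-colour {s} slim vx λ y≢v y-two xy →
      ⊥-elim (y≢v (D.other-idle vx (x≢ u-one) (x≢ u′-one) xy (two⇒Outside {s} y-two))))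
    where
    module D = Double opt hole u≢u′ vu vu′ u-one u′-one
    module D′ = Double opt hole (u≢u′ ∘ ≡.sym) vu′ vu u′-one u-one

    x≢ : ∀ {w} → s ! w ≡ one j → x ≢ w
    x≢ w-one refl = i≢j (one-injective (trans (≡.sym x-one) w-one))

    slim : Slim s v
    slim {a} va ay y-out y≢v az z-out z≢v with a ≟ u | a ≟ u′
    ... | no a≢u | no a≢u′ = ⊥-elim (y≢v (D.other-idle va a≢u a≢u′ ay y-out))
    slim va (inj₁ refl) y-out y≢v az z-out z≢v | yes refl | _ = ⊥-elim (y-out j u-one)
    slim va (inj₂ ay) y-out y≢v (inj₁ refl) z-out z≢v | yes refl | _ = ⊥-elim (z-out j u-one)
    slim va (inj₂ ay) y-out y≢v (inj₂ az) z-out z≢v | yes refl | _ =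
      D.crowded ay y-out y≢v az z-out z≢v
    slim va (inj₁ refl) y-out y≢v az z-out z≢v | no _ | yes refl = ⊥-elim (y-out j u′-one)
    slim va (inj₂ ay) y-out y≢v (inj₁ refl) z-out z≢v | no _ | yes refl = ⊥-elim (z-out j u′-one)
    slim va (inj₂ ay) y-out y≢v (inj₂ az) z-out z≢v | no _ | yes refl =
      D′.crowded ay y-out y≢v az z-out z≢v

  -- Excluding uncoloured vertices.

  -- If the neighbour x of v in the class of index 0 has a further neighbour y outside, then y
  -- has two neighbours in that class, and the lack of a colour can be passed from v to y.
  no-adjacent-outside : ∀ {s v w} → Optimal s → s ! v ≡ none → Adj v w → Outside s w → ⊥
  no-adjacent-outside {s} {v} {w} opt hole vw w-out
    with x , vx , x-one ← outside-sees opt (none⇒Outside {s} hole) zero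
    with any? (λ y → ¬? (y ≟ v) ×-dec ¬? (y ≟ w) ×-dec Outside? s y ×-dec Adj? x y)
  ... | no ∄ = hole-blocked opt hole (free-colour {s} slim vx idle)
    where
    slim : Slim s v
    slim = adjacent-outside⇒Slim opt hole vw w-out
    -- The only conflict that can pass through `x` is `w`, itself adjacent to `v`.
    idle : ∀ {y j} → y ≢ v → s ! y ≡ two j → Adj[ x ] y → Adj v y × y ≢ x
    idle y≢v y-two (inj₁ refl) = ⊥-elim (two⇒Outside {s} y-two _ x-one)
    idle {y} y≢v y-two (inj₂ xy) with y ≟ w
    ... | yes refl = vw , Adj⇒≢ xy ∘ ≡.sym
    ... | no y≢w = ⊥-elim (∄ (y , y≢v , y≢w , two⇒Outside {s} y-two , xy))
  ... | yes (y , y≢v , y≢w , y-out , xy) =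
    -- After the exchange `x` is uncoloured and `v`, now in the class of index 0, is not adjacent to
    -- `y`. Hence `y` sees that class in a third vertex, which was there before.
    second-neighbour (outside-sees optimal′ (Outside′ y≢v y-out) zero)
    where
    sees-v : ∀ i → Sees s v i
    sees-v = outside-sees opt (none⇒Outside {s} hole)

    open Swap opt hole vx x-one (one-private {s} sees-v vw w-out vx x-one)

    ¬vy : ¬ Adj v y
    ¬vy vy = y≢w (outside-unique {s} sees-v vy y-out vw w-out)

    t : State
    t = s [ y ]≔ none

    Outside-t : ∀ {z} → Outside t z → Outside s z
    Outside-t {z} z-out with z ≟ y
    ... | yes refl = y-out
    ... | no z≢y = λ i eq → z-out i (trans (kept s none z≢y) eq)

    slim : Slim t v
    slim va ab b-out b≢v ac c-out c≢v = adjacent-outside⇒Slim opt hole vw w-out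
      va ab (Outside-t b-out) b≢v ac (Outside-t c-out) c≢v

    -- Apart from `v`, the only neighbour of `x` outside is `y`, so uncolouring `y` leaves `x`
    -- without conflicts.
    idle : ∀ {z j} → z ≢ v → t ! z ≡ two j → Adj[ x ] z → Adj v z × z ≢ x
    idle z≢v z-two (inj₁ refl) = ⊥-elim (Outside-t (two⇒Outside {t} z-two) _ x-one)
    idle z≢v z-two (inj₂ xz)
      with refl ← private-outside-unique xz (Outside-t (two⇒Outside {t} z-two)) z≢v xy y-out y≢v
      with () ← trans (≡.sym z-two) (updated s y none)

    hole-t : t ! v ≡ none
    hole-t = trans (kept s none (y≢v ∘ ≡.sym)) hole

    second-neighbour : ¬ Sees s′ y zero
    second-neighbour (z , yz , z-one) = passed (s ! y) refl y-out
      where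
      z≢v : z ≢ v
      z≢v refl = ¬vy (Adj-sym yz)
      z≢x : z ≢ x
      z≢x refl with () ← trans (≡.sym z-one) at-x
      z-one-s : s ! z ≡ one zero
      z-one-s = trans (≡.sym (elsewhere z≢v z≢x)) z-one

      passed : ∀ c → s ! y ≡ c → (∀ i → s ! y ≢ one i) → ⊥
      passed (one i) y-one out = out i y-one
      passed none y-none _ = no-double opt y-none z≢x yz (Adj-sym xy) z-one-s x-one
      -- At equal weight `y` gives up its colour and `v` takes one of radius 2; then `y` is
      -- uncoloured with `x` and `z` in one class.
      passed (two _) y-two _ with j , fits ← free-colour {t} slim vx idle =
        no-double opt″ (trans (kept t (two j) y≢v) (updated s y none)) z≢x yz (Adj-sym xy)
          (unchanged z≢v (Adj⇒≢ yz ∘ ≡.sym) z-one-s)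
          (unchanged (Adj⇒≢ vx ∘ ≡.sym) (Adj⇒≢ xy) x-one)
        where
        opt″ : Optimal (t [ v ]≔ two j)
        opt″ = recolour-two-Optimal s y none v (two j) opt (λ _ ()) fits
          (≡.sym (≡.cong₂ _+_ (cong cost y-two) (cong cost hole-t)))
        unchanged : ∀ {b c} → b ≢ v → b ≢ y → s ! b ≡ c → (t [ v ]≔ two j) ! b ≡ c
        unchanged b≢v b≢y eq = trans (kept t (two j) b≢v) (trans (kept s none b≢y) eq)

  -- With no neighbour outside and no two neighbours in one class, every neighbour is private and
  -- carries no conflict.
  no-hole : ∀ {s v} → Optimal s → s ! v ≢ none
  no-hole {s} {v} opt hole
    with x , vx , x-one ← outside-sees opt (none⇒Outside {s} hole) zero =
    hole-blocked opt hole (free-colour {s}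
      (λ va ay y-out y≢v _ _ _ → ⊥-elim (y≢v (all-idle va ay y-out))) vx λ y≢v y-two xy → ⊥-elim (y≢v (all-idle vx xy (two⇒Outside {s} y-two))))
    where
    inside : ∀ {w} → Adj v w → ¬ Outside s w
    inside vw w-out = no-adjacent-outside opt hole vw w-out

    all-idle : ∀ {a y} → Adj v a → Adj[ a ] y → Outside s y → y ≡ v
    all-idle va (inj₁ refl) y-out = ⊥-elim (inside va y-out)
    all-idle {a} va (inj₂ ay) y-out with class (s ! a)
    ... | inj₂ a-out = ⊥-elim (inside va a-out)
    ... | inj₁ (i , a-one) = private-no-other-outside opt hole inside va a-one
      (λ {b} vb b-one → decidable-stable (b ≟ a) λ b≢a →
        no-double opt hole b≢a vb va b-one a-one) ay y-out

  -- From minimal colourings to packing colourings.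

  number : ∀ c → c ≢ none → Fin (K + k)
  number (one i) _ = i ↑ˡ k
  number (two j) _ = K ↑ʳ j
  number none    c≢none = ⊥-elim (c≢none refl)

  radius : Color → ℕ
  radius (one _) = 1
  radius (two _) = 2
  -- The default 0 makes `close⇒Conflict` vacuous for `none`: no walk of length 0 joins distinct
  -- vertices.
  radius none    = 0

  lookup-number : ∀ c c≢none → lookup (seq1^2^ k) (number c c≢none) ≡ radius c
  lookup-number (one i) _ =
    trans (lookup-++ˡ (replicate K 1) (replicate k 2) i) (lookup-replicate i 1)
  lookup-number (two j) _ =
    trans (lookup-++ʳ (replicate K 1) (replicate k 2) j) (lookup-replicate j 2)
  lookup-number none c≢none = ⊥-elim (c≢none refl)

  number-injective : ∀ c d c≢none d≢none → number c c≢none ≡ number d d≢none → c ≡ d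
  number-injective (one i) (one j) _ _ eq = cong one (↑ˡ-injective k i j eq)
  number-injective (two i) (two j) _ _ eq = cong two (↑ʳ-injective K i j eq)
  number-injective (one i) (two j) _ _ eq
    with () ← trans (≡.sym (splitAt-↑ˡ K i k)) (trans (cong (splitAt K) eq) (splitAt-↑ʳ K k j))
  number-injective (two i) (one j) _ _ eq
    with () ← trans (≡.sym (splitAt-↑ʳ K k i)) (trans (cong (splitAt K) eq) (splitAt-↑ˡ K j k))
  number-injective none d c≢none _ _ = ⊥-elim (c≢none refl)
  number-injective c none _ d≢none _ = ⊥-elim (d≢none refl)

  close⇒Conflict : ∀ c {x y l} → x ≢ y → l ≤ radius c → Walk G x y l → Conflict c x y
  close⇒Conflict c x≢y l≤ nil = ⊥-elim (x≢y refl)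
  close⇒Conflict (one _) x≢y l≤ (cons xy nil) = xy
  close⇒Conflict (one _) x≢y (s≤s ()) (cons _ (cons _ _))
  close⇒Conflict (two _) x≢y l≤ (cons xy nil) = x≢y ∘ ≡.sym , _ , xy , inj₁ refl
  close⇒Conflict (two _) x≢y l≤ (cons xa (cons ay nil)) = x≢y ∘ ≡.sym , _ , xa , inj₂ ay
  close⇒Conflict (two _) x≢y (s≤s (s≤s ())) (cons _ (cons _ (cons _ _)))

  packing-colorable : SPackingColorable G (seq1^2^ k)
  packing-colorable with s , opt ← ∃-Optimal =
    (λ x → number (s ! x) (no-hole opt)) , λ x y x≢y eq l l≤ walk →
      valid opt x y
        (close⇒Conflict (s ! x) x≢y
          (subst (l ≤_) (lookup-number (s ! x) (no-hole opt)) l≤) walk)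
        (number-injective (s ! x) (s ! y) (no-hole opt) (no-hole opt) eq)

theorem5p1 : (k : ℕ) → 3 ≤ k → (G : Graph) → MaxDegree≤ G k →
    SPackingColorable G (seq1^2^ k)
theorem5p1 (suc (suc (suc m))) (s≤s (s≤s (s≤s _))) G Δ≤k =
  PartialColourings.packing-colorable G m Δ≤k
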